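{- For every integer $n\ge 1$, the origami flip graph ${\rm OFG}(M_{2,n})$ of the $2\times n$ Miura-ori has exactly $2\cdot 3^{n-1}$ vertices.
   Context: The $2\times n$ Miura-ori $M_{2,n}$ ($n\ge 1$) is the crease pattern made of $2$ rows and $n$ columns of congruent parallelograms, with faces $\alpha_{i,j}$ ($i\in\{1,2\}$ the row, $j\in\{1,\dots,n\}$ the column). Its interior vertices are $x_1,\dots,x_{n-1}$ (on the middle line, left to right) and its creases are $e_0$ together with $e_{3k-1},e_{3k},e_{3k+1}$ for $k=1,\dots,n-1$ (so $3n-2$ creases; we write $e_0$ also as $e_{3\cdot 1-3}$). At $x_k$ the incident creases are: left $e_{3k-3}$, top $e_{3k-1}$, right $e_{3k}$, bottom $e_{3k+1}$; the two sector angles adjacent to the left crease are obtuse, the other two are acute. Face $\alpha_{1,j}$ is bordered by those of $e_{3j-4}$ (present iff $j\ge2$), $e_{3j-3}$, $e_{3j-1}$ (present iff $j\le n-1$); face $\alpha_{2,j}$ is bordered by those of $e_{3j-2}$ (present iff $j\ge 2$), $e_{3j-3}$, $e_{3j+1}$ (present iff $j\le n-1$). A mountain–valley (MV) assignment is a map $\mu$ from the creases to $\{1,-1\}$ ($1$ = mountain $M$, $-1$ = valley $V$). It is locally valid if for every $k=1,\dots,n-1$ exactly one of $\mu(e_{3k-1}),\mu(e_{3k}),\mu(e_{3k+1})$ differs from $\mu(e_{3k-3})$ (equivalently: at each vertex three creases have one parity and one the other, and the minority crease is not the one between the two obtuse angles). The face flip of $\alpha$ turns $\mu$ into $\mu_\alpha$,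 which negates $\mu$ on the creases bordering $\alpha$ and agrees with $\mu$ elsewhere; $\alpha$ is flippable under $\mu$ if both $\mu$ and $\mu_\alpha$ are locally valid. ${\rm OFG}(M_{2,n})$ is the graph whose vertices are the locally valid MV assignments of $M_{2,n}$, with $\mu\sim\mu_\alpha$ whenever $\alpha$ is flippable under $\mu$. -}

module Defs where

open import Data.Bool.Base using (true; false; if_then_else_)
open import Data.Fin.Base using (Fin; zero; suc; toℕ; inject₁)
open import Data.Nat.Base using (ℕ; zero; suc; pred; _+_; _*_; _∸_)
open import Data.Nat.Properties using (_≟_; +-comm; *-suc)
open import Data.Product using (Σ; ∃; ∃!; _×_; _,_; proj₁; proj₂)
open import Data.Sign.Base using (Sign; opposite)
open import Data.Sign.Properties using (opposite-involutive; s≢opposite[s])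
open import Data.Sum.Base using (_⊎_; inj₁; inj₂)
open import Level using (0ℓ)
open import Relation.Binary.Bundles using (Setoid)
open import Relation.Binary.Core using (Rel)
open import Relation.Binary.Definitions using (Symmetric; Irreflexive; _Respects₂_)
open import Relation.Binary.PropositionalEquality using (_≡_; _≢_; _≗_; refl; sym; trans; cong)
open import Relation.Nullary using (Dec; does; yes; no; ¬_; contradiction)
open import Relation.Nullary.Decidable using (_⊎-dec_)

-- Simple undirected graphs; the vertices form a setoid so that vertices may
-- be functions, compared pointwise.
record SimpleGraph : Set₁ where
  field
    vertices : Setoid 0ℓ 0ℓ
  open Setoid vertices public using () renaming (Carrier to Vertex; _≈_ to _≈ᵛ_)
  field
    Adjacent            : Rel Vertex 0ℓ
    adjacent-sym        : Symmetric Adjacent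
    adjacent-irrefl     : Irreflexive _≈ᵛ_ Adjacent
    adjacent-respects-≈ : Adjacent Respects₂ _≈ᵛ_

-- The element k stands for x_{k+1}.
InteriorVertex : ℕ → Set
InteriorVertex n = Fin (pred n)

data Direction : Set where
  top right bottom : Direction

-- Each crease other than e₀ is the top, right or bottom crease of a unique
-- interior vertex.
data Crease (n : ℕ) : Set where
  e₀ : Crease n
  at : InteriorVertex n → Direction → Crease n

-- The subscript i in the name e_i; no crease has subscript 1.
label : ∀ {n} → Crease n → ℕ
label e₀            = 0
label (at k top)    = 3 * suc (toℕ k) ∸ 1
label (at k right)  = 3 * suc (toℕ k)
label (at k bottom) = 3 * suc (toℕ k) + 1

-- e_{3k-3}, the crease between the two obtuse angles at x_k.
left : ∀ {n} → InteriorVertex n → Crease n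
left {suc _} zero    = e₀
left {suc _} (suc k) = at (inject₁ k) right

data Row : Set where
  row₁ row₂ : Row

-- α i j is the face in row i and column j + 1.
data Face (n : ℕ) : Set where
  α : Row → Fin n → Face n

-- In row 1 and column J the bordering creases are those of e_{3J-4}, e_{3J-3},
-- e_{3J-1} that exist; in row 2 those of e_{3J-2}, e_{3J-3}, e_{3J+1}.  The
-- subscripts that must be excluded at the two ends (-1, 1, 3n-1, 3n+1) are not
-- labels of creases.
Borders : ∀ {n} → Face n → Crease n → Set
Borders (α row₁ j) c = let J = suc (toℕ j) in
  label c + 4 ≡ 3 * J ⊎ label c + 3 ≡ 3 * J ⊎ label c + 1 ≡ 3 * J
Borders (α row₂ j) c = let J = suc (toℕ j) in
  label c + 2 ≡ 3 * J ⊎ label c + 3 ≡ 3 * J ⊎ label c ≡ 3 * J + 1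

borders? : ∀ {n} (f : Face n) (c : Crease n) → Dec (Borders f c)
borders? (α row₁ j) c = (_ ≟ _) ⊎-dec (_ ≟ _) ⊎-dec (_ ≟ _)
borders? (α row₂ j) c = (_ ≟ _) ⊎-dec (_ ≟ _) ⊎-dec (_ ≟ _)

-- Sign.+ is mountain (1), Sign.- is valley (-1).
MVAssignment : ℕ → Set
MVAssignment n = Crease n → Sign

LocallyValid : ∀ {n} → MVAssignment n → Set
LocallyValid {n} μ = (k : InteriorVertex n) → ∃! _≡_ λ d → μ (at k d) ≢ μ (left k)

flip : ∀ {n} → Face n → MVAssignment n → MVAssignment n
flip f μ c = if does (borders? f c) then opposite (μ c) else μ c

Flippable : ∀ {n} → Face n → MVAssignment n → Set
Flippable f μ = LocallyValid μ × LocallyValid (flip f μ)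

flip-cong : ∀ {n} (f : Face n) {μ ν : MVAssignment n} → μ ≗ ν → flip f μ ≗ flip f ν
flip-cong f eq c with does (borders? f c)
... | true  = cong opposite (eq c)
... | false = eq c

flip-involutive : ∀ {n} (f : Face n) (μ : MVAssignment n) → flip f (flip f μ) ≗ μ
flip-involutive f μ c with does (borders? f c)
... | true  = opposite-involutive (μ c)
... | false = refl

locallyValid-resp-≗ : ∀ {n} {μ ν : MVAssignment n} → μ ≗ ν → LocallyValid μ → LocallyValid ν
locallyValid-resp-≗ eq valid k with valid k
... | d , differs , unique =
  d , (λ q → differs (trans (eq _) (trans q (sym (eq _))))) ,
  λ differs′ → unique (λ q → differs′ (trans (sym (eq _)) (trans q (eq _))))

middle : ∀ {n} → Fin n → Crease n
middle {suc _}       zero    = e₀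
middle {suc (suc _)} (suc j) = at j right

label-middle : ∀ {n} (j : Fin n) → label (middle j) + 3 ≡ 3 * suc (toℕ j)
label-middle {suc _}       zero    = refl
label-middle {suc (suc _)} (suc j) =
  trans (+-comm (3 * suc (toℕ j)) 3) (sym (*-suc 3 (suc (toℕ j))))

borders-some : ∀ {n} (f : Face n) → ∃ (Borders f)
borders-some (α row₁ j) = middle j , inj₂ (inj₁ (label-middle j))
borders-some (α row₂ j) = middle j , inj₂ (inj₁ (label-middle j))

flip-≢ : ∀ {n} (f : Face n) (μ : MVAssignment n) → ¬ (μ ≗ flip f μ)
flip-≢ f μ eq with borders-some f
... | c , b with borders? f c | eq c
...   | yes _ | q = s≢opposite[s] (μ c) q
...   | no ¬b | _ = contradiction b ¬b

validAssignments : ℕ → Setoid 0ℓ 0ℓ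
validAssignments n = record
  { Carrier       = Σ (MVAssignment n) LocallyValid
  ; _≈_           = λ v w → proj₁ v ≗ proj₁ w
  ; isEquivalence = record
    { refl  = λ _ → refl
    ; sym   = λ p c → sym (p c)
    ; trans = λ p q c → trans (p c) (q c)
    }
  }

OFG : ℕ → SimpleGraph
OFG n = record
  { vertices            = validAssignments n
  ; Adjacent            = Adj
  ; adjacent-sym        = λ {v} {w} → adj-sym {v} {w}
  ; adjacent-irrefl     = λ {v} {w} → adj-irrefl {v} {w}
  ; adjacent-respects-≈ =
      (λ { {v} {w} {w′} w≈w′ (f , fl , eq) → f , fl , λ c → trans (sym (w≈w′ c)) (eq c) })
    , (λ { {w} {v} {v′} v≈v′ (f , (_ , valid) , eq) →
           f , (proj₂ v′ , locallyValid-resp-≗ (flip-cong f v≈v′) valid)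
             , λ c → trans (eq c) (flip-cong f v≈v′ c) })
  }
  where
  open Setoid (validAssignments n) using (Carrier; _≈_)

  Adj : Rel Carrier 0ℓ
  Adj (μ , _) (ν , _) = ∃ λ f → Flippable f μ × ν ≗ flip f μ

  adj-sym : Symmetric Adj
  adj-sym {μ , μ-valid} {ν , ν-valid} (f , _ , eq) =
    f , (ν-valid , locallyValid-resp-≗ back μ-valid) , back
    where
    back : μ ≗ flip f ν
    back c = sym (trans (flip-cong f eq c) (flip-involutive f μ c))

  adj-irrefl : Irreflexive _≈_ Adj
  adj-irrefl {μ , _} μ≈ν (f , _ , eq) = flip-≢ f μ (λ c → trans (μ≈ν c) (eq c))

{-# OPTIONS --safe #-}

-- A locally valid assignment is determined by the sign of e₀ together with,
-- for each interior vertex x_k, the unique direction in which the crease at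
-- x_k disagrees with its left crease.  Since the left crease of x_{k+1} is the
-- right crease of x_k, the signs propagate from left to right, and the 2
-- choices at e₀ and the 3 choices at each of the n - 1 vertices are free.
module Submission where

open import Defs
open import Data.Bool.Base using (if_then_else_)
open import Data.Fin.Base using (Fin; zero; suc; combine; funToFin; finToFun)
open import Data.Fin.Patterns using (0F; 1F; 2F)
open import Data.Fin.Properties using (*↔×; funToFin-finToFin; finToFun-funToFin)
open import Data.Nat.Base using (ℕ; zero; suc; _*_; _^_; _∸_; _≤_)
open import Data.Product using (∃!; _×_; _,_; proj₁; proj₂)
open import Data.Product.Function.NonDependent.Setoid using (_×-inverse_)
open import Data.Product.Relation.Binary.Pointwise.NonDependent using (_×ₛ_; Pointwise-≡↔≡)
open import Data.Sign.Base using (Sign; opposite)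
open import Data.Sign.Properties using (s≢opposite[s]) renaming (_≟_ to _≟ˢ_)
open import Function.Base using (_∘_)
open import Function.Bundles using (Inverse; _↔_; mk↔ₛ′)
open import Function.Construct.Composition using (inverse)
open import Function.Construct.Symmetry using () renaming (inverse to inverse-sym)
open import Level using (0ℓ)
open import Relation.Binary.Bundles using (Setoid)
open import Relation.Binary.Definitions using (DecidableEquality)
open import Relation.Binary.PropositionalEquality using (_≡_; _≢_; _≗_; _→-setoid_; refl; sym; trans; cong; cong₂; setoid)
open import Relation.Nullary using (does; yes; no; contradiction)

sign↔Fin2 : Sign ↔ Fin 2
sign↔Fin2 = mk↔ₛ′
  (λ { Sign.- → 0F ; Sign.+ → 1F })
  (λ { 0F → Sign.- ; 1F → Sign.+ })
  (λ { 0F → refl ; 1F → refl })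
  (λ { Sign.- → refl ; Sign.+ → refl })

direction↔Fin3 : Direction ↔ Fin 3
direction↔Fin3 = mk↔ₛ′
  (λ { top → 0F ; right → 1F ; bottom → 2F })
  (λ { 0F → top ; 1F → right ; 2F → bottom })
  (λ { 0F → refl ; 1F → refl ; 2F → refl })
  (λ { top → refl ; right → refl ; bottom → refl })

_≟ᵈ_ : DecidableEquality Direction
top    ≟ᵈ top    = yes refl
top    ≟ᵈ right  = no λ ()
top    ≟ᵈ bottom = no λ ()
right  ≟ᵈ top    = no λ ()
right  ≟ᵈ right  = yes refl
right  ≟ᵈ bottom = no λ ()
bottom ≟ᵈ top    = no λ ()
bottom ≟ᵈ right  = no λ ()
bottom ≟ᵈ bottom = yes refl

funToFin-cong : ∀ {m k} {f g : Fin m → Fin k} → f ≗ g → funToFin f ≡ funToFin g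
funToFin-cong {zero}  f≗g = refl
funToFin-cong {suc m} f≗g = cong₂ combine (f≗g zero) (funToFin-cong (f≗g ∘ suc))

-- Functions are compared pointwise, so the domain is a setoid; the values become the base-`k`
-- digits of a number below `k ^ m`.
→-setoid↔^ : ∀ {A : Set} {k} m → A ↔ Fin k → Inverse (Fin m →-setoid A) (setoid (Fin (k ^ m)))
→-setoid↔^ {k = k} m A↔k = record
  { to        = λ f → funToFin (to ∘ f)
  ; from      = λ i → from ∘ finToFun i
  ; to-cong   = λ f≗g → funToFin-cong (cong to ∘ f≗g)
  ; from-cong = λ { refl _ → refl }
  ; inverse   =
      (λ {i} f≗i → trans
        (funToFin-cong (λ j → trans (cong to (f≗i j)) (strictlyInverseˡ (finToFun i j))))
        (funToFin-finToFin {m} {k} i))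
    , (λ { {f} refl j → trans (cong from (finToFun-funToFin (to ∘ f) j)) (strictlyInverseʳ (f j)) })
  }
  where open Inverse A↔k

-- The sign of the crease in direction d at a vertex whose left crease has sign s
-- and whose unique disagreeing crease has direction δ.
signAt : Direction → Sign → Direction → Sign
signAt δ s d = if does (δ ≟ᵈ d) then opposite s else s

signAt-self : ∀ δ s → signAt δ s δ ≢ s
signAt-self δ s with δ ≟ᵈ δ
... | yes _  = s≢opposite[s] s ∘ sym
... | no δ≢δ = contradiction refl δ≢δ

signAt-≢ : ∀ δ s {d} → signAt δ s d ≢ s → δ ≡ d
signAt-≢ δ s {d} differs with δ ≟ᵈ d
... | yes δ≡d = δ≡d
... | no  _   = contradiction refl differs

≢⇒≡opposite : ∀ {s t} → s ≢ t → s ≡ opposite t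
≢⇒≡opposite {Sign.-} {Sign.-} s≢t = contradiction refl s≢t
≢⇒≡opposite {Sign.-} {Sign.+} s≢t = refl
≢⇒≡opposite {Sign.+} {Sign.-} s≢t = refl
≢⇒≡opposite {Sign.+} {Sign.+} s≢t = contradiction refl s≢t

-- There are only two signs: in direction `δ` disagreement with `s` forces `opposite s`, and
-- elsewhere disagreement would contradict uniqueness of `δ`.
signAt-unique : ∀ {s} (t : Direction → Sign) ((δ , _) : ∃! _≡_ λ d → t d ≢ s) → t ≗ signAt δ s
signAt-unique {s} t (δ , differs , unique) d with δ ≟ᵈ d
... | yes refl = ≢⇒≡opposite differs
... | no  δ≢d with t d ≟ˢ s
...   | yes td≡s = td≡s
...   | no  td≢s = contradiction (unique td≢s) δ≢d

Encoding : ℕ → Set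
Encoding m = Sign × (Fin m → Direction)

-- The propagation rule as equations on `μ` itself, mediating between validity and the recursive
-- `assign`.
record Realises {m} (c : Encoding m) (μ : MVAssignment (suc m)) : Set where
  constructor realises
  field
    start : μ e₀ ≡ proj₁ c
    local : ∀ k d → μ (at k d) ≡ signAt (proj₂ c k) (μ (left k)) d

-- Cutting off the first column turns the right crease of the first vertex into the new `e₀`, which
-- makes induction on the columns possible.
dropFirst : ∀ {m} → MVAssignment (suc (suc m)) → MVAssignment (suc m)
dropFirst μ e₀       = μ (at zero right)
dropFirst μ (at k d) = μ (at (suc k) d)

dropFirst-left : ∀ {m} (μ : MVAssignment (suc (suc m))) k → dropFirst μ (left k) ≡ μ (left (suc k))
dropFirst-left μ zero    = refl
dropFirst-left μ (suc k) = refl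

assign : ∀ {m} → Encoding m → MVAssignment (suc m)
assign (s , δ) e₀             = s
assign (s , δ) (at zero d)    = signAt (δ zero) s d
assign (s , δ) (at (suc k) d) = assign (signAt (δ zero) s right , δ ∘ suc) (at k d)

assign-realises : ∀ {m} (c : Encoding m) → Realises c (assign c)
assign-realises c = realises refl (local c)
  where
  local : ∀ {m} (c : Encoding m) k d → assign c (at k d) ≡ signAt (proj₂ c k) (assign c (left k)) d
  local c       zero          d = refl
  local (s , δ) (suc zero)    d = refl
  local (s , δ) (suc (suc k)) d = local (signAt (δ zero) s right , δ ∘ suc) (suc k) d

-- Induction from left to right: the equations fix the signs at the first vertex, and `dropFirst μ`
-- realises the shifted encoding.
realises-unique : ∀ {m} {s} {δ : Fin m → Direction} {μ} → Realises (s , δ) μ → μ ≗ assign (s , δ)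
realises-unique (realises start local) e₀ = start
realises-unique {δ = δ} (realises start local) (at zero d) =
  trans (local zero d) (cong (λ s → signAt (δ zero) s d) start)
realises-unique {δ = δ} {μ} (realises start local) (at (suc k) d) =
  realises-unique {μ = dropFirst μ}
    (realises
      (trans (local zero right) (cong (λ s → signAt (δ zero) s right) start))
      (λ j d′ → trans (local (suc j) d′)
                      (cong (λ s → signAt (δ (suc j)) s d′) (sym (dropFirst-left μ j)))))
    (at k d)

-- The witness is `δ k` itself, so encoding an assignment with this proof returns `δ` by
-- computation.
realises⇒valid : ∀ {m} {c : Encoding m} {μ} → Realises c μ → LocallyValid μ
realises⇒valid {c = s , δ} {μ} (realises _ local) k =
    δ k
  , (λ eq → signAt-self (δ k) (μ (left k)) (trans (sym (local k (δ k))) eq))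
  , (λ {d} differs → signAt-≢ (δ k) (μ (left k)) (λ eq → differs (trans (local k d) eq)))

encode : ∀ {m} (μ : MVAssignment (suc m)) → LocallyValid μ → Encoding m
encode μ valid = μ e₀ , proj₁ ∘ valid

encode-realised : ∀ {m} (μ : MVAssignment (suc m)) (valid : LocallyValid μ) → Realises (encode μ valid) μ
encode-realised μ valid = realises refl (λ k → signAt-unique (λ d → μ (at k d)) (valid k))

realises-resp : ∀ {m} {s t} {δ ε : Fin m → Direction} {μ} → s ≡ t → δ ≗ ε →
  Realises (s , δ) μ → Realises (t , ε) μ
realises-resp {μ = μ} s≡t δ≗ε (realises start local) =
  realises (trans start s≡t)
           (λ k d → trans (local k d) (cong (λ x → signAt x (μ (left k)) d) (δ≗ε k)))

encodings : ℕ → Setoid 0ℓ 0ℓ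
encodings m = setoid Sign ×ₛ (Fin m →-setoid Direction)

validAssignments↔encodings : ∀ m → Inverse (validAssignments (suc m)) (encodings m)
validAssignments↔encodings m = record
  { to        = λ (μ , valid) → encode μ valid
  ; from      = λ c → assign c , realises⇒valid (assign-realises c)
  ; to-cong   = λ {v} {w} → encode-cong {v} {w}
  -- An assignment realising one encoding realises every pointwise equal one, so uniqueness gives
  -- the congruence.
  ; from-cong = λ { {c} (s≡t , δ≗ε) → realises-unique (realises-resp s≡t δ≗ε (assign-realises c)) }
  ; inverse   =
      -- Encoding `assign c` yields `c` definitionally, so only congruence remains.
      (λ {c} {v} → encode-cong {v} {assign c , realises⇒valid (assign-realises c)})
    , (λ { {μ , valid} (s≡t , δ≗ε) e →
           sym (realises-unique (realises-resp (sym s≡t) (sym ∘ δ≗ε) (encode-realised μ valid)) e) })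
  }
  where
  open Setoid (validAssignments (suc m)) using (Carrier; _≈_)

  -- The two validity proofs may differ, but the direction disagreeing under `μ` also disagrees
  -- under `ν`, where it is unique.
  encode-cong : ∀ {v w : Carrier} → v ≈ w →
    Setoid._≈_ (encodings m) (encode (proj₁ v) (proj₂ v)) (encode (proj₁ w) (proj₂ w))
  encode-cong {μ , valid} {ν , valid′} μ≗ν =
    μ≗ν e₀ , λ k → sym (proj₂ (proj₂ (valid′ k))
      (λ eq → proj₁ (proj₂ (valid k)) (trans (μ≗ν _) (trans eq (sym (μ≗ν _))))))

theorem3p1 : (n : ℕ) → 1 ≤ n →
    Inverse (SimpleGraph.vertices (OFG n)) (setoid (Fin (2 * 3 ^ (n ∸ 1))))
theorem3p1 (suc m) _ =
  inverse (validAssignments↔encodings m)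
  (inverse (sign↔Fin2 ×-inverse →-setoid↔^ m direction↔Fin3)
  -- Componentwise equality on pairs is traded for propositional equality before the two factors are
  -- multiplied.
  (inverse Pointwise-≡↔≡ (inverse-sym *↔×)))
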